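{- Let $n\ge1$ and let $\lambda=(\lambda_1\ge\dots\ge\lambda_n\ge0)$ be a partition. The sequence of Hall--Littlewood polynomials $\{P_{k\lambda}(\mathbf{x};t)\}_{k=1}^\infty$ in $\mathbf{x}=(x_1,\dots,x_n)$ satisfies a linear recurrence.
   Context: $k\lambda=(k\lambda_1,\dots,k\lambda_n)$. The Hall--Littlewood $P$ polynomials are $$P_\lambda(\mathbf{x};t)=\left(\prod_{i\ge0}\prod_{j=1}^{m_\lambda(i)}\frac{1-t}{1-t^j}\right)\sum_{\sigma\in S_n}\sigma\left(x_1^{\lambda_1}\cdots x_n^{\lambda_n}\prod_{i<j}\frac{x_i-tx_j}{x_i-x_j}\right),$$ where $m_\lambda(i)$ is the number of parts of $\lambda=(\lambda_1,\dots,\lambda_n)$ equal to $i$ (including $i=0$), and $\sigma$ acts on the indices of the variables. A sequence $\{a_k\}_{k\ge1}$ of polynomials satisfies a linear recurrence if there are $r\ge1$ and polynomials $c_1,\dots,c_r$ in the given variables, independent of $k$, such that $a_k+c_1a_{k-1}+\dots+c_ra_{k-r}=0$ for all $k\ge r+1$. -}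

module Defs where

open import Level using (0ℓ)
open import Function.Base using (_∘_)
open import Function.Bundles using (Injection)
open import Function.Properties.Inverse using (↔⇒↣)
open import Data.Empty using (⊥-elim)
open import Data.Product using (Σ; _×_; _,_; ∃; proj₂)
open import Data.Sum using (inj₁; inj₂)
open import Data.Nat as ℕ using (ℕ; zero; suc)
import Data.Nat.Properties as ℕ
import Data.Integer as ℤ
import Data.Integer.Properties as ℤ
open import Data.Fin as Fin using (Fin; zero; suc; toℕ; Fin′; inject)
import Data.Fin.Properties as Fin
open import Data.Fin.Permutation as Perm using (Permutation; _⟨$⟩ʳ_)
open import Data.List as List using (List; []; _∷_)
open import Data.List.Membership.Propositional.Properties using (∈-allFin)
open import Data.List.Relation.Unary.AllPairs as AllPairs using (AllPairs; []; _∷_)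
import Data.List.Relation.Unary.AllPairs.Properties as AllPairs
import Data.List.Relation.Unary.All as All
import Data.List.Relation.Unary.All.Properties as All
open import Data.List.Relation.Unary.Unique.Propositional.Properties using (allFin⁺)
open import Data.List.Relation.Unary.Any as Any using (Any; here)
import Data.List.Relation.Unary.Any.Properties as Any
open import Data.Vec as Vec using (Vec; lookup)
open import Data.Vec.Functional using (Vector)
open import Data.Vec.Relation.Unary.Linked as Linked using (Linked)
import Data.Vec.Relation.Unary.Linked.Properties as Linked
open import Relation.Nullary using (Dec; yes; no; ¬_)
open import Relation.Nullary.Decidable using (map′; _×-dec_)
open import Relation.Binary using (Decidable; IsEquivalence; Setoid)
import Relation.Binary.Reasoning.Setoid as SetoidReasoning
open import Relation.Binary.PropositionalEquality as ≡ using (_≡_; _≢_)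
open import Algebra.Bundles using (CommutativeRing; Semiring; AbelianGroup)
open import Algebra.Structures
open import Algebra.Consequences.Setoid using (comm∧idˡ⇒id; comm∧distrˡ⇒distr)
import Algebra.Properties.Ring as RingProperties
import Algebra.Properties.CommutativeSemigroup as CommutativeSemigroupProperties
import Algebra.Definitions.RawSemiring as RawSemiring
import Algebra.Solver.Ring.NaturalCoefficients.Default as SemiringSolver

record IntegralDomain : Set₁ where
  field
    commutativeRing : CommutativeRing 0ℓ 0ℓ

  open CommutativeRing commutativeRing public

  infix 4 _≟_
  field
    _≟_            : Decidable _≈_
    1≉0            : 1# ≉ 0#
    noZeroDivisors : ∀ {x y} → x * y ≈ 0# → x ≉ 0# → y ≈ 0#

  open RawSemiring (Semiring.rawSemiring (CommutativeRing.semiring commutativeRing)) public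
    using (_^_; sum; product)

  open RingProperties ring public
    using (-‿distribˡ-*; -‿distribʳ-*; x∙y⁻¹≈ε⇒x≈y; x≈y⇒x∙y⁻¹≈ε; -0#≈0#)

  *-cancelˡ : ∀ {x y z} → x ≉ 0# → x * y ≈ x * z → y ≈ z
  *-cancelˡ {x} {y} {z} x≉0 xy≈xz = x∙y⁻¹≈ε⇒x≈y y z (noZeroDivisors (begin
    x * (y - z)        ≈⟨ distribˡ x y (- z) ⟩
    x * y + x * - z    ≈⟨ +-congˡ (-‿distribʳ-* x z) ⟨
    x * y - x * z      ≈⟨ x≈y⇒x∙y⁻¹≈ε xy≈xz ⟩
    0#                 ∎) x≉0)
    where open SetoidReasoning setoid

  *-nonZero : ∀ {x y} → x ≉ 0# → y ≉ 0# → x * y ≉ 0#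
  *-nonZero x≉0 y≉0 xy≈0 = y≉0 (noZeroDivisors xy≈0 x≉0)

ℤ-integralDomain : IntegralDomain
ℤ-integralDomain = record
  { commutativeRing = ℤ.+-*-commutativeRing
  ; _≟_             = ℤ._≟_
  ; 1≉0             = λ ()
  ; noZeroDivisors  = noZeroDivisors
  }
  where
  noZeroDivisors : ∀ {x y} → x ℤ.* y ≡ ℤ.0ℤ → x ≢ ℤ.0ℤ → y ≡ ℤ.0ℤ
  noZeroDivisors {x} xy≡0 x≢0 with ℤ.i*j≡0⇒i≡0∨j≡0 x xy≡0
  ... | inj₁ x≡0 = ⊥-elim (x≢0 x≡0)
  ... | inj₂ y≡0 = y≡0

module Polynomial (D : IntegralDomain) where

  private module D = IntegralDomain D
  open D using (0#; 1#; _≈_; _≉_)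

  -- a₀ ∷ a₁ ∷ … ∷ aₘ ∷ [] is a₀ + a₁X + … + aₘXᵐ; trailing zeros are allowed.
  Poly : Set
  Poly = List D.Carrier

  coeff : Poly → ℕ → D.Carrier
  coeff []      _       = 0#
  coeff (a ∷ p) zero    = a
  coeff (a ∷ p) (suc i) = coeff p i

  infix 4 _≈ₚ_
  record _≈ₚ_ (p q : Poly) : Set where
    constructor coeffwise
    field at : ∀ i → coeff p i ≈ coeff q i
  open _≈ₚ_ public

  infixl 6 _+ₚ_
  infixl 7 _*ₚ_ _·_

  _+ₚ_ : Poly → Poly → Poly
  []      +ₚ q       = q
  (a ∷ p) +ₚ []      = a ∷ p
  (a ∷ p) +ₚ (b ∷ q) = a D.+ b ∷ p +ₚ q

  -ₚ_ : Poly → Poly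
  -ₚ p = List.map (λ a → D.- a) p

  _·_ : D.Carrier → Poly → Poly
  a · p = List.map (a D.*_) p

  _*ₚ_ : Poly → Poly → Poly
  []      *ₚ q = []
  (a ∷ p) *ₚ q = a · q +ₚ (0# ∷ p *ₚ q)

  C : D.Carrier → Poly
  C a = a ∷ []

  X : Poly
  X = 0# ∷ 1# ∷ []

  coeff-+ : ∀ p q i → coeff (p +ₚ q) i ≈ coeff p i D.+ coeff q i
  coeff-+ []      q       i       = D.sym (D.+-identityˡ _)
  coeff-+ (a ∷ p) []      i       = D.sym (D.+-identityʳ _)
  coeff-+ (a ∷ p) (b ∷ q) zero    = D.refl
  coeff-+ (a ∷ p) (b ∷ q) (suc i) = coeff-+ p q i

  coeff-neg : ∀ p i → coeff (-ₚ p) i ≈ D.- coeff p i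
  coeff-neg []      i       = D.sym D.-0#≈0#
  coeff-neg (a ∷ p) zero    = D.refl
  coeff-neg (a ∷ p) (suc i) = coeff-neg p i

  coeff-· : ∀ a p i → coeff (a · p) i ≈ a D.* coeff p i
  coeff-· a []      i       = D.sym (D.zeroʳ a)
  coeff-· a (b ∷ p) zero    = D.refl
  coeff-· a (b ∷ p) (suc i) = coeff-· a p i

  ≈ₚ-isEquivalence : IsEquivalence _≈ₚ_
  ≈ₚ-isEquivalence = record
    { refl  = coeffwise λ i → D.refl
    ; sym   = λ e → coeffwise λ i → D.sym (at e i)
    ; trans = λ e f → coeffwise λ i → D.trans (at e i) (at f i)
    }

  open IsEquivalence ≈ₚ-isEquivalence public
    renaming (refl to ≈ₚ-refl; sym to ≈ₚ-sym; trans to ≈ₚ-trans)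

  +ₚ-cong : ∀ {p p′ q q′} → p ≈ₚ p′ → q ≈ₚ q′ → p +ₚ q ≈ₚ p′ +ₚ q′
  +ₚ-cong {p} {p′} {q} {q′} e f = coeffwise λ i →
    D.trans (coeff-+ p q i) (D.trans (D.+-cong (at e i) (at f i)) (D.sym (coeff-+ p′ q′ i)))

  +ₚ-assoc : ∀ p q r → (p +ₚ q) +ₚ r ≈ₚ p +ₚ (q +ₚ r)
  +ₚ-assoc p q r = coeffwise λ i → begin
    coeff ((p +ₚ q) +ₚ r) i                   ≈⟨ coeff-+ (p +ₚ q) r i ⟩
    coeff (p +ₚ q) i D.+ coeff r i            ≈⟨ D.+-congʳ (coeff-+ p q i) ⟩
    (coeff p i D.+ coeff q i) D.+ coeff r i   ≈⟨ D.+-assoc _ _ _ ⟩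
    coeff p i D.+ (coeff q i D.+ coeff r i)   ≈⟨ D.+-congˡ (coeff-+ q r i) ⟨
    coeff p i D.+ coeff (q +ₚ r) i            ≈⟨ coeff-+ p (q +ₚ r) i ⟨
    coeff (p +ₚ (q +ₚ r)) i                   ∎
    where open SetoidReasoning D.setoid

  +ₚ-comm : ∀ p q → p +ₚ q ≈ₚ q +ₚ p
  +ₚ-comm p q = coeffwise λ i →
    D.trans (coeff-+ p q i) (D.trans (D.+-comm _ _) (D.sym (coeff-+ q p i)))

  +ₚ-identityʳ : ∀ p → p +ₚ [] ≈ₚ p
  +ₚ-identityʳ p = +ₚ-comm p []

  -ₚ-cong : ∀ {p q} → p ≈ₚ q → -ₚ p ≈ₚ -ₚ q
  -ₚ-cong {p} {q} e = coeffwise λ i →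
    D.trans (coeff-neg p i) (D.trans (D.-‿cong (at e i)) (D.sym (coeff-neg q i)))

  -ₚ-inverseˡ : ∀ p → (-ₚ p) +ₚ p ≈ₚ []
  -ₚ-inverseˡ p = coeffwise λ i → D.trans (coeff-+ (-ₚ p) p i)
    (D.trans (D.+-congʳ (coeff-neg p i)) (D.-‿inverseˡ _))

  +ₚ-isAbelianGroup : IsAbelianGroup _≈ₚ_ _+ₚ_ [] -ₚ_
  +ₚ-isAbelianGroup = record
    { isGroup = record
      { isMonoid = record
        { isSemigroup = record
          { isMagma = record { isEquivalence = ≈ₚ-isEquivalence ; ∙-cong = +ₚ-cong }
          ; assoc   = +ₚ-assoc
          }
        ; identity = (λ _ → ≈ₚ-refl) , +ₚ-identityʳ
        }
      ; inverse = -ₚ-inverseˡ , λ p → ≈ₚ-trans (+ₚ-comm p (-ₚ p)) (-ₚ-inverseˡ p)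
      ; ⁻¹-cong = -ₚ-cong
      }
    ; comm = +ₚ-comm
    }

  private
    +ₚ-abelianGroup : AbelianGroup 0ℓ 0ℓ
    +ₚ-abelianGroup = record { isAbelianGroup = +ₚ-isAbelianGroup }

    ≈ₚ-setoid : Setoid 0ℓ 0ℓ
    ≈ₚ-setoid = AbelianGroup.setoid +ₚ-abelianGroup

  open CommutativeSemigroupProperties (AbelianGroup.commutativeSemigroup +ₚ-abelianGroup)
    using (x∙yz≈y∙xz; interchange)
  module ≈ₚ-Reasoning = SetoidReasoning ≈ₚ-setoid
  open ≈ₚ-Reasoning

  +ₚ-congˡ : ∀ p {q r} → q ≈ₚ r → p +ₚ q ≈ₚ p +ₚ r
  +ₚ-congˡ p = +ₚ-cong (≈ₚ-refl {p})

  +ₚ-congʳ : ∀ p {q r} → q ≈ₚ r → q +ₚ p ≈ₚ r +ₚ p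
  +ₚ-congʳ p e = +ₚ-cong e (≈ₚ-refl {p})

  ∷-cong : ∀ {a b p q} → a ≈ b → p ≈ₚ q → a ∷ p ≈ₚ b ∷ q
  ∷-cong a≈b p≈q = coeffwise λ { zero → a≈b ; (suc i) → at p≈q i }

  ∷-head : ∀ {a b p q} → a ∷ p ≈ₚ b ∷ q → a ≈ b
  ∷-head e = at e zero

  ∷-tail : ∀ {a b p q} → a ∷ p ≈ₚ b ∷ q → p ≈ₚ q
  ∷-tail e = coeffwise λ i → at e (suc i)

  0∷[]≈[] : 0# ∷ [] ≈ₚ []
  0∷[]≈[] = coeffwise λ { zero → D.refl ; (suc i) → D.refl }

  0∷-+ : ∀ p q → 0# ∷ (p +ₚ q) ≈ₚ (0# ∷ p) +ₚ (0# ∷ q)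
  0∷-+ p q = ∷-cong (D.sym (D.+-identityˡ 0#)) ≈ₚ-refl

  ·-cong : ∀ {a b p q} → a ≈ b → p ≈ₚ q → a · p ≈ₚ b · q
  ·-cong {a} {b} {p} {q} a≈b p≈q = coeffwise λ i →
    D.trans (coeff-· a p i) (D.trans (D.*-cong a≈b (at p≈q i)) (D.sym (coeff-· b q i)))

  0·p≈[] : ∀ {a} p → a ≈ 0# → a · p ≈ₚ []
  0·p≈[] {a} p a≈0 = coeffwise λ i →
    D.trans (coeff-· a p i) (D.trans (D.*-congʳ a≈0) (D.zeroˡ _))

  1·p≈p : ∀ p → 1# · p ≈ₚ p
  1·p≈p p = coeffwise λ i → D.trans (coeff-· 1# p i) (D.*-identityˡ _)

  ·-+ : ∀ a p q → a · (p +ₚ q) ≈ₚ a · p +ₚ a · q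
  ·-+ a []      q       = ≈ₚ-refl
  ·-+ a (b ∷ p) []      = ≈ₚ-refl
  ·-+ a (b ∷ p) (c ∷ q) = ∷-cong (D.distribˡ a b c) (·-+ a p q)

  ·-0∷ : ∀ a p → a · (0# ∷ p) ≈ₚ 0# ∷ a · p
  ·-0∷ a p = ∷-cong (D.zeroʳ a) ≈ₚ-refl

  ·-assoc : ∀ a b p → (a D.* b) · p ≈ₚ a · (b · p)
  ·-assoc a b []      = ≈ₚ-refl
  ·-assoc a b (c ∷ p) = ∷-cong (D.*-assoc a b c) (·-assoc a b p)

  0∷-* : ∀ p q → (0# ∷ p) *ₚ q ≈ₚ 0# ∷ p *ₚ q
  0∷-* p q = +ₚ-congʳ _ (0·p≈[] q D.refl)

  *ₚ-zeroʳ : ∀ p → p *ₚ [] ≈ₚ []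
  *ₚ-zeroʳ []      = ≈ₚ-refl
  *ₚ-zeroʳ (a ∷ p) = ≈ₚ-trans (∷-cong D.refl (*ₚ-zeroʳ p)) 0∷[]≈[]

  *ₚ-∷ : ∀ p b q → p *ₚ (b ∷ q) ≈ₚ b · p +ₚ (0# ∷ p *ₚ q)
  *ₚ-∷ []      b q = ≈ₚ-sym 0∷[]≈[]
  *ₚ-∷ (a ∷ p) b q = ∷-cong (D.+-congʳ (D.*-comm a b)) (begin
    a · q +ₚ p *ₚ (b ∷ q)               ≈⟨ +ₚ-congˡ (a · q) (*ₚ-∷ p b q) ⟩
    a · q +ₚ (b · p +ₚ (0# ∷ p *ₚ q))   ≈⟨ x∙yz≈y∙xz (a · q) (b · p) _ ⟩
    b · p +ₚ (a · q +ₚ (0# ∷ p *ₚ q))   ∎)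

  *ₚ-comm : ∀ p q → p *ₚ q ≈ₚ q *ₚ p
  *ₚ-comm p []      = *ₚ-zeroʳ p
  *ₚ-comm p (b ∷ q) = ≈ₚ-trans (*ₚ-∷ p b q)
    (+ₚ-congˡ (b · p) (∷-cong D.refl (*ₚ-comm p q)))

  *ₚ-congˡ : ∀ p {q r} → q ≈ₚ r → p *ₚ q ≈ₚ p *ₚ r
  *ₚ-congˡ []      e = ≈ₚ-refl
  *ₚ-congˡ (a ∷ p) e = +ₚ-cong (·-cong D.refl e) (∷-cong D.refl (*ₚ-congˡ p e))

  *ₚ-cong : ∀ {p p′ q q′} → p ≈ₚ p′ → q ≈ₚ q′ → p *ₚ q ≈ₚ p′ *ₚ q′
  *ₚ-cong {p} {p′} {q} {q′} e f = begin
    p *ₚ q     ≈⟨ *ₚ-congˡ p f ⟩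
    p *ₚ q′    ≈⟨ *ₚ-comm p q′ ⟩
    q′ *ₚ p    ≈⟨ *ₚ-congˡ q′ e ⟩
    q′ *ₚ p′   ≈⟨ *ₚ-comm q′ p′ ⟩
    p′ *ₚ q′   ∎

  *ₚ-distribˡ : ∀ p q r → p *ₚ (q +ₚ r) ≈ₚ p *ₚ q +ₚ p *ₚ r
  *ₚ-distribˡ []      q r = ≈ₚ-refl
  *ₚ-distribˡ (a ∷ p) q r = begin
    a · (q +ₚ r) +ₚ (0# ∷ p *ₚ (q +ₚ r))
      ≈⟨ +ₚ-cong (·-+ a q r) (≈ₚ-trans (∷-cong D.refl (*ₚ-distribˡ p q r)) (0∷-+ (p *ₚ q) (p *ₚ r))) ⟩
    (a · q +ₚ a · r) +ₚ ((0# ∷ p *ₚ q) +ₚ (0# ∷ p *ₚ r))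
      ≈⟨ interchange (a · q) (a · r) (0# ∷ p *ₚ q) (0# ∷ p *ₚ r) ⟩
    (a · q +ₚ (0# ∷ p *ₚ q)) +ₚ (a · r +ₚ (0# ∷ p *ₚ r)) ∎

  *ₚ-distrib : (∀ p q r → p *ₚ (q +ₚ r) ≈ₚ p *ₚ q +ₚ p *ₚ r)
             × (∀ p q r → (q +ₚ r) *ₚ p ≈ₚ q *ₚ p +ₚ r *ₚ p)
  *ₚ-distrib = comm∧distrˡ⇒distr ≈ₚ-setoid +ₚ-cong *ₚ-comm *ₚ-distribˡ

  ·-* : ∀ a p q → (a · p) *ₚ q ≈ₚ a · (p *ₚ q)
  ·-* a []      q = ≈ₚ-refl
  ·-* a (b ∷ p) q = begin
    (a D.* b) · q +ₚ (0# ∷ (a · p) *ₚ q)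
      ≈⟨ +ₚ-cong (·-assoc a b q) (≈ₚ-trans (∷-cong D.refl (·-* a p q)) (≈ₚ-sym (·-0∷ a (p *ₚ q)))) ⟩
    a · (b · q) +ₚ a · (0# ∷ p *ₚ q)
      ≈⟨ ·-+ a (b · q) (0# ∷ p *ₚ q) ⟨
    a · (b · q +ₚ (0# ∷ p *ₚ q)) ∎

  *ₚ-assoc : ∀ p q r → (p *ₚ q) *ₚ r ≈ₚ p *ₚ (q *ₚ r)
  *ₚ-assoc []      q r = ≈ₚ-refl
  *ₚ-assoc (a ∷ p) q r = begin
    (a · q +ₚ (0# ∷ p *ₚ q)) *ₚ r
      ≈⟨ proj₂ *ₚ-distrib r (a · q) (0# ∷ p *ₚ q) ⟩
    (a · q) *ₚ r +ₚ (0# ∷ p *ₚ q) *ₚ r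
      ≈⟨ +ₚ-cong (·-* a q r) (≈ₚ-trans (0∷-* (p *ₚ q) r) (∷-cong D.refl (*ₚ-assoc p q r))) ⟩
    a · (q *ₚ r) +ₚ (0# ∷ p *ₚ (q *ₚ r)) ∎

  *ₚ-identityˡ : ∀ p → C 1# *ₚ p ≈ₚ p
  *ₚ-identityˡ p = begin
    1# · p +ₚ (0# ∷ [])   ≈⟨ +ₚ-cong (1·p≈p p) 0∷[]≈[] ⟩
    p +ₚ []               ≈⟨ +ₚ-identityʳ p ⟩
    p                     ∎

  commutativeRing : CommutativeRing 0ℓ 0ℓ
  commutativeRing = record
    { Carrier = Poly
    ; _≈_     = _≈ₚ_
    ; _+_     = _+ₚ_
    ; _*_     = _*ₚ_
    ; -_      = -ₚ_
    ; 0#      = []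
    ; 1#      = C 1#
    ; isCommutativeRing = record
      { isRing = record
        { +-isAbelianGroup = +ₚ-isAbelianGroup
        ; *-cong           = *ₚ-cong
        ; *-assoc          = *ₚ-assoc
        ; *-identity       = comm∧idˡ⇒id ≈ₚ-setoid *ₚ-comm *ₚ-identityˡ
        ; distrib          = *ₚ-distrib
        }
      ; *-comm = *ₚ-comm
      }
    }

  _≟ₚ_ : Decidable _≈ₚ_
  [] ≟ₚ [] = yes ≈ₚ-refl
  [] ≟ₚ (b ∷ q) = map′
    (λ (e , f) → coeffwise λ { zero → e ; (suc i) → at f i })
    (λ e → at e zero , coeffwise λ i → at e (suc i))
    ((0# D.≟ b) ×-dec ([] ≟ₚ q))
  (a ∷ p) ≟ₚ [] = map′
    (λ (e , f) → coeffwise λ { zero → e ; (suc i) → at f i })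
    (λ e → at e zero , coeffwise λ i → at e (suc i))
    ((a D.≟ 0#) ×-dec (p ≟ₚ []))
  (a ∷ p) ≟ₚ (b ∷ q) = map′
    (λ (e , f) → ∷-cong e f) (λ e → ∷-head e , ∷-tail e)
    ((a D.≟ b) ×-dec (p ≟ₚ q))

  *ₚ-noZeroDivisors : ∀ p q → p *ₚ q ≈ₚ [] → ¬ (p ≈ₚ []) → q ≈ₚ []
  *ₚ-noZeroDivisors []      q       pq≈0 p≉0 = ⊥-elim (p≉0 ≈ₚ-refl)
  *ₚ-noZeroDivisors (a ∷ p) []      pq≈0 p≉0 = ≈ₚ-refl
  *ₚ-noZeroDivisors (a ∷ p) (b ∷ q) pq≈0 p≉0 =
    step (a D.≟ 0#) (*ₚ-noZeroDivisors p (b ∷ q)) (*ₚ-noZeroDivisors (a ∷ p) q)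
    where
    step : Dec (a ≈ 0#) →
           (p *ₚ (b ∷ q) ≈ₚ [] → ¬ (p ≈ₚ []) → b ∷ q ≈ₚ []) →
           ((a ∷ p) *ₚ q ≈ₚ [] → ¬ (a ∷ p ≈ₚ []) → q ≈ₚ []) →
           b ∷ q ≈ₚ []
    step (yes a≈0) rec _ = rec
      (∷-tail {0#} {0#} (begin
        0# ∷ p *ₚ (b ∷ q)                     ≈⟨ +ₚ-congʳ _ (0·p≈[] (b ∷ q) a≈0) ⟨
        a · (b ∷ q) +ₚ (0# ∷ p *ₚ (b ∷ q))    ≈⟨ pq≈0 ⟩
        []                                    ≈⟨ 0∷[]≈[] ⟨
        0# ∷ []                               ∎))
      (λ p≈0 → p≉0 (≈ₚ-trans (∷-cong a≈0 p≈0) 0∷[]≈[]))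
    step (no a≉0) _ rec = ≈ₚ-trans (∷-cong b≈0 q≈0) 0∷[]≈[]
      where
      b≈0 : b ≈ 0#
      b≈0 = D.noZeroDivisors (D.trans (D.sym (D.+-identityʳ _)) (at pq≈0 zero)) a≉0

      q≈0 : q ≈ₚ []
      q≈0 = rec
        (∷-tail {0#} {0#} (begin
          0# ∷ (a ∷ p) *ₚ q                   ≈⟨ +ₚ-congʳ _ (0·p≈[] (a ∷ p) b≈0) ⟨
          b · (a ∷ p) +ₚ (0# ∷ (a ∷ p) *ₚ q)  ≈⟨ *ₚ-∷ (a ∷ p) b q ⟨
          (a ∷ p) *ₚ (b ∷ q)                  ≈⟨ pq≈0 ⟩
          []                                  ≈⟨ 0∷[]≈[] ⟨
          0# ∷ []                             ∎))
        p≉0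

  integralDomain : IntegralDomain
  integralDomain = record
    { commutativeRing = commutativeRing
    ; _≟_             = _≟ₚ_
    ; 1≉0             = λ e → D.1≉0 (at e zero)
    ; noZeroDivisors  = λ {p} {q} → *ₚ-noZeroDivisors p q
    }

module FieldOfFractions (D : IntegralDomain) where

  open IntegralDomain D
  open SemiringSolver commutativeSemiring

  infixl 7 _/_[_]
  record Fraction : Set where
    constructor _/_[_]
    field
      num den : Carrier
      den≉0   : den ≉ 0#
  open Fraction public

  infix 4 _≈ᶠ_
  record _≈ᶠ_ (x y : Fraction) : Set where
    constructor cross
    field cross-multiplied : num x * den y ≈ num y * den x
  open _≈ᶠ_ public

  infixl 6 _+ᶠ_
  infixl 7 _*ᶠ_

  _+ᶠ_ _*ᶠ_ : Fraction → Fraction → Fraction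
  (a / b [ b≉0 ]) +ᶠ (c / d [ d≉0 ]) = (a * d + c * b) / (b * d) [ *-nonZero b≉0 d≉0 ]
  (a / b [ b≉0 ]) *ᶠ (c / d [ d≉0 ]) = (a * c) / (b * d) [ *-nonZero b≉0 d≉0 ]

  -ᶠ_ : Fraction → Fraction
  -ᶠ (a / b [ b≉0 ]) = (- a) / b [ b≉0 ]

  ι : Carrier → Fraction
  ι a = a / 1# [ 1≉0 ]

  open SetoidReasoning setoid

  ≈ᶠ-isEquivalence : IsEquivalence _≈ᶠ_
  ≈ᶠ-isEquivalence = record
    { refl  = cross refl
    ; sym   = λ (cross e) → cross (sym e)
    ; trans = λ {x} {y} {z} (cross e) (cross f) → cross (*-cancelˡ (den≉0 y) (begin
        den y * (num x * den z) ≈⟨ solve 3 (λ a b c → a :* (b :* c) := (b :* a) :* c) refl (den y) (num x) (den z) ⟩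
        (num x * den y) * den z ≈⟨ *-congʳ e ⟩
        (num y * den x) * den z ≈⟨ solve 3 (λ a b c → (a :* b) :* c := b :* (a :* c)) refl (num y) (den x) (den z) ⟩
        den x * (num y * den z) ≈⟨ *-congˡ f ⟩
        den x * (num z * den y) ≈⟨ solve 3 (λ a b c → a :* (b :* c) := c :* (b :* a)) refl (den x) (num z) (den y) ⟩
        den y * (num z * den x) ∎))
    }

  +ᶠ-cong : ∀ {x x′ y y′} → x ≈ᶠ x′ → y ≈ᶠ y′ → x +ᶠ y ≈ᶠ x′ +ᶠ y′
  +ᶠ-cong {a / b [ _ ]} {a′ / b′ [ _ ]} {c / d [ _ ]} {c′ / d′ [ _ ]} (cross e) (cross f) = cross (begin
    (a * d + c * b) * (b′ * d′)
      ≈⟨ solve 6 (λ a b c d b′ d′ → (a :* d :+ c :* b) :* (b′ :* d′)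
           := (a :* b′) :* (d :* d′) :+ (c :* d′) :* (b :* b′)) refl a b c d b′ d′ ⟩
    (a * b′) * (d * d′) + (c * d′) * (b * b′)
      ≈⟨ +-cong (*-congʳ e) (*-congʳ f) ⟩
    (a′ * b) * (d * d′) + (c′ * d) * (b * b′)
      ≈⟨ solve 6 (λ a′ b c′ d b′ d′ → (a′ :* b) :* (d :* d′) :+ (c′ :* d) :* (b :* b′)
           := (a′ :* d′ :+ c′ :* b′) :* (b :* d)) refl a′ b c′ d b′ d′ ⟩
    (a′ * d′ + c′ * b′) * (b * d) ∎)

  *ᶠ-cong : ∀ {x x′ y y′} → x ≈ᶠ x′ → y ≈ᶠ y′ → x *ᶠ y ≈ᶠ x′ *ᶠ y′
  *ᶠ-cong {a / b [ _ ]} {a′ / b′ [ _ ]} {c / d [ _ ]} {c′ / d′ [ _ ]} (cross e) (cross f) = cross (begin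
    (a * c) * (b′ * d′)   ≈⟨ solve 4 (λ a c b d → (a :* c) :* (b :* d) := (a :* b) :* (c :* d)) refl a c b′ d′ ⟩
    (a * b′) * (c * d′)   ≈⟨ *-cong e f ⟩
    (a′ * b) * (c′ * d)   ≈⟨ solve 4 (λ a b c d → (a :* b) :* (c :* d) := (a :* c) :* (b :* d)) refl a′ b c′ d ⟩
    (a′ * c′) * (b * d)   ∎)

  ι-injective : ∀ {a b} → ι a ≈ᶠ ι b → a ≈ b
  ι-injective {a} {b} (cross e) = trans (sym (*-identityʳ a)) (trans e (*-identityʳ b))

  -ᶠ-cong : ∀ {x y} → x ≈ᶠ y → -ᶠ x ≈ᶠ -ᶠ y
  -ᶠ-cong {a / b [ _ ]} {c / d [ _ ]} (cross e) = cross (begin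
    - a * d     ≈⟨ -‿distribˡ-* a d ⟨
    - (a * d)   ≈⟨ -‿cong e ⟩
    - (c * b)   ≈⟨ -‿distribˡ-* c b ⟩
    - c * b     ∎)

  private
    ≈ᶠ-setoid : Setoid 0ℓ 0ℓ
    ≈ᶠ-setoid = record { isEquivalence = ≈ᶠ-isEquivalence }

  +ᶠ-comm : ∀ x y → x +ᶠ y ≈ᶠ y +ᶠ x
  +ᶠ-comm (a / b [ _ ]) (c / d [ _ ]) = cross (solve 4 (λ a b c d →
    (a :* d :+ c :* b) :* (d :* b) := (c :* b :+ a :* d) :* (b :* d)) refl a b c d)

  +ᶠ-assoc : ∀ x y z → (x +ᶠ y) +ᶠ z ≈ᶠ x +ᶠ (y +ᶠ z)
  +ᶠ-assoc (a / b [ _ ]) (c / d [ _ ]) (e / f [ _ ]) = cross (solve 6 (λ a b c d e f →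
    ((a :* d :+ c :* b) :* f :+ e :* (b :* d)) :* (b :* (d :* f))
      := (a :* (d :* f) :+ (c :* f :+ e :* d) :* b) :* ((b :* d) :* f)) refl a b c d e f)

  +ᶠ-identityˡ : ∀ x → ι 0# +ᶠ x ≈ᶠ x
  +ᶠ-identityˡ (a / b [ _ ]) = cross (solve 2 (λ a b →
    (con 0 :* b :+ a :* con 1) :* b := a :* (con 1 :* b)) refl a b)

  -ᶠ-inverseˡ : ∀ x → (-ᶠ x) +ᶠ x ≈ᶠ ι 0#
  -ᶠ-inverseˡ (a / b [ _ ]) = cross (begin
    (- a * b + a * b) * 1#   ≈⟨ *-identityʳ _ ⟩
    - a * b + a * b          ≈⟨ distribʳ b (- a) a ⟨
    (- a + a) * b            ≈⟨ *-congʳ (-‿inverseˡ a) ⟩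
    0# * b                   ≈⟨ zeroˡ b ⟩
    0#                       ≈⟨ zeroˡ _ ⟨
    0# * (b * b)             ∎)

  *ᶠ-comm : ∀ x y → x *ᶠ y ≈ᶠ y *ᶠ x
  *ᶠ-comm (a / b [ _ ]) (c / d [ _ ]) = cross (solve 4 (λ a b c d →
    (a :* c) :* (d :* b) := (c :* a) :* (b :* d)) refl a b c d)

  *ᶠ-assoc : ∀ x y z → (x *ᶠ y) *ᶠ z ≈ᶠ x *ᶠ (y *ᶠ z)
  *ᶠ-assoc (a / b [ _ ]) (c / d [ _ ]) (e / f [ _ ]) = cross (solve 6 (λ a b c d e f →
    ((a :* c) :* e) :* (b :* (d :* f)) := (a :* (c :* e)) :* ((b :* d) :* f)) refl a b c d e f)

  *ᶠ-identityˡ : ∀ x → ι 1# *ᶠ x ≈ᶠ x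
  *ᶠ-identityˡ (a / b [ _ ]) = cross (solve 2 (λ a b →
    (con 1 :* a) :* b := a :* (con 1 :* b)) refl a b)

  *ᶠ-distribˡ : ∀ x y z → x *ᶠ (y +ᶠ z) ≈ᶠ x *ᶠ y +ᶠ x *ᶠ z
  *ᶠ-distribˡ (a / b [ _ ]) (c / d [ _ ]) (e / f [ _ ]) = cross (solve 6 (λ a b c d e f →
    (a :* (c :* f :+ e :* d)) :* ((b :* d) :* (b :* f))
      := ((a :* c) :* (b :* f) :+ (a :* e) :* (b :* d)) :* (b :* (d :* f))) refl a b c d e f)

  fractionRing : CommutativeRing 0ℓ 0ℓ
  fractionRing = record
    { Carrier = Fraction
    ; _≈_     = _≈ᶠ_
    ; _+_     = _+ᶠ_
    ; _*_     = _*ᶠ_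
    ; -_      = -ᶠ_
    ; 0#      = ι 0#
    ; 1#      = ι 1#
    ; isCommutativeRing = record
      { isRing = record
        { +-isAbelianGroup = record
          { isGroup = record
            { isMonoid = record
              { isSemigroup = record
                { isMagma = record { isEquivalence = ≈ᶠ-isEquivalence ; ∙-cong = +ᶠ-cong }
                ; assoc   = +ᶠ-assoc
                }
              ; identity = comm∧idˡ⇒id ≈ᶠ-setoid +ᶠ-comm {e = ι 0#} +ᶠ-identityˡ
              }
            ; inverse = -ᶠ-inverseˡ
                      , λ x → IsEquivalence.trans ≈ᶠ-isEquivalence (+ᶠ-comm x (-ᶠ x)) (-ᶠ-inverseˡ x)
            ; ⁻¹-cong = -ᶠ-cong
            }
          ; comm = +ᶠ-comm
          }
        ; *-cong     = *ᶠ-cong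
        ; *-assoc    = *ᶠ-assoc
        ; *-identity = comm∧idˡ⇒id ≈ᶠ-setoid *ᶠ-comm {e = ι 1#} *ᶠ-identityˡ
        ; distrib    = comm∧distrˡ⇒distr ≈ᶠ-setoid +ᶠ-cong *ᶠ-comm *ᶠ-distribˡ
        }
      ; *-comm = *ᶠ-comm
      }
    }

-- ℤ[X₀, …, Xₘ₋₁], built as (ℤ[X₁, …, Xₘ₋₁])[X₀].
ℤ[X_] : ℕ → IntegralDomain
ℤ[X zero  ] = ℤ-integralDomain
ℤ[X suc m ] = Polynomial.integralDomain ℤ[X m ]

var : ∀ {m} → Fin m → IntegralDomain.Carrier ℤ[X m ]
var {suc m} zero    = Polynomial.X ℤ[X m ]
var {suc m} (suc i) = Polynomial.C ℤ[X m ] (var i)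

var-distinct : ∀ {m} {i j : Fin m} → i ≢ j →
               IntegralDomain._≉_ ℤ[X m ] (var i) (var j)
var-distinct {suc m} {zero}  {zero}  i≢j _ = i≢j ≡.refl
var-distinct {suc m} {zero}  {suc j} _   e =
  IntegralDomain.1≉0 ℤ[X m ] (Polynomial.at e 1)
var-distinct {suc m} {suc i} {zero}  _   e =
  IntegralDomain.1≉0 ℤ[X m ] (IntegralDomain.sym ℤ[X m ] (Polynomial.at e 1))
var-distinct {suc m} {suc i} {suc j} i≢j e =
  var-distinct {m} (i≢j ∘ ≡.cong suc) (Polynomial.at e 0)

-- π is determined by j = π(0) together with the induced bijection between
-- the complements of 0 and of j.
permutations : ∀ n → List (Permutation n n)
permutations zero    = Perm.id ∷ []
permutations (suc n) = List.concatMap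
  (λ j → List.map (Perm.insert zero j) (permutations n)) (List.allFin (suc n))

permutations-complete : ∀ {n} (π : Permutation n n) → Any (π Perm.≈_) (permutations n)
permutations-complete {zero}  π = here λ ()
permutations-complete {suc n} π =
  Any.concatMap⁺ _ (Any.map
    (λ { ≡.refl → Any.map⁺ (Any.map
      (λ {ρ} e i → ≡.trans (≡.sym (Perm.insert-remove zero π i)) (insert-cong e i))
      (permutations-complete (Perm.remove zero π))) })
    (∈-allFin (π ⟨$⟩ʳ zero)))
  where
  insert-cong : ∀ {j} {π ρ : Permutation n n} → π Perm.≈ ρ →
                Perm.insert zero j π Perm.≈ Perm.insert zero j ρ
  insert-cong e zero    = ≡.refl
  insert-cong e (suc i) = ≡.cong (Fin.punchIn _) (e i)

permutations-unique : ∀ n → AllPairs (λ π ρ → ¬ (π Perm.≈ ρ)) (permutations n)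
permutations-unique zero    = All.[] ∷ []
permutations-unique (suc n) = AllPairs.concat⁺
  (All.map⁺ (All.universal
    (λ j → AllPairs.map⁺ (AllPairs.map (_∘ insert-injective j) (permutations-unique n)))
    (List.allFin (suc n))))
  (AllPairs.map⁺ (AllPairs.map
    (λ j≢k → All.map⁺ (All.universal
      (λ π → All.map⁺ (All.universal (λ ρ e → j≢k (e zero)) (permutations n)))
      (permutations n)))
    (allFin⁺ (suc n))))
  where
  insert-injective : ∀ j {π ρ : Permutation n n} →
                     Perm.insert zero j π Perm.≈ Perm.insert zero j ρ → π Perm.≈ ρ
  insert-injective j e i = Fin.punchIn-injective j _ _ (e (suc i))

record Partition (n : ℕ) : Set where
  constructor partition
  field
    parts      : Vec ℕ n
    decreasing : Linked ℕ._≥_ parts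
open Partition public

multiplicity : ∀ {n} → Partition n → ℕ → ℕ
multiplicity μ i = Vec.count (ℕ._≟ i) (parts μ)

largestPart : ∀ {n} → Partition n → ℕ
largestPart μ = Vec.foldr (λ _ → ℕ) ℕ._⊔_ 0 (parts μ)

infixr 7 _⊛_
_⊛_ : ∀ {n} → ℕ → Partition n → Partition n
k ⊛ partition μ μ≥ = partition (Vec.map (k ℕ.*_) μ)
  (Linked.map⁺ (Linked.map (ℕ.*-monoʳ-≤ k) μ≥))

module HallLittlewood (n : ℕ) where

  ℤ[𝐱,t] : IntegralDomain
  ℤ[𝐱,t] = ℤ[X suc n ]

  module R = IntegralDomain ℤ[𝐱,t]
  open FieldOfFractions ℤ[𝐱,t] public using (Fraction; _/_[_]; ι; fractionRing)

  module K where
    open CommutativeRing fractionRing public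
    open RawSemiring (Semiring.rawSemiring semiring) public using (sum; product)

  t : R.Carrier
  t = var {suc n} zero

  x : Fin n → R.Carrier
  x i = var {suc n} (suc i)

  1-tʲ≉0 : ∀ j → R.1# R.- t R.^ suc j R.≉ R.0#
  1-tʲ≉0 j e = IntegralDomain.1≉0 ℤ[X n ]
    (at (R.trans (R.x∙y⁻¹≈ε⇒x≈y R.1# (t R.^ suc j) e)
                 (0∷-* (IntegralDomain.1# ℤ[X n ] ∷ []) (t R.^ j))) 0)
    where open Polynomial ℤ[X n ]

  xᵢ-xⱼ≉0 : ∀ {i j} → i ≢ j → x i R.- x j R.≉ R.0#
  xᵢ-xⱼ≉0 {i} {j} i≢j e =
    var-distinct {suc n} {suc i} {suc j} (i≢j ∘ Fin.suc-injective) (R.x∙y⁻¹≈ε⇒x≈y (x i) (x j) e)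

  σ-distinct : ∀ (σ : Permutation n n) {j} (i : Fin′ j) → σ ⟨$⟩ʳ inject i ≢ σ ⟨$⟩ʳ j
  σ-distinct σ {j} i e = ℕ.<⇒≢ (Fin.toℕ<n i)
    (≡.trans (≡.sym (Fin.toℕ-inject i)) (≡.cong toℕ (Injection.injective (↔⇒↣ σ) e)))

  -- Every multiplicity beyond the largest part is 0, so the product over all
  -- i ≥ 0 is the product over 0 ≤ i ≤ λ₁.
  normalisation : Partition n → Fraction
  normalisation μ =
    K.product {suc (largestPart μ)} λ i →
      K.product {multiplicity μ (toℕ i)} λ j →
        (R.1# R.- t) / (R.1# R.- t R.^ suc (toℕ j)) [ 1-tʲ≉0 (toℕ j) ]

  -- σ(x₁^λ₁ ⋯ xₙ^λₙ ∏_{i<j} (xᵢ - t xⱼ)/(xᵢ - xⱼ)), with σ(xᵢ) = x_{σ(i)} and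
  -- σ(t) = t.  For j : Fin n, inject maps Fin′ j onto the indices i < j.
  summand : Partition n → Permutation n n → Fraction
  summand μ σ =
    ι (R.product λ i → x (σ ⟨$⟩ʳ i) R.^ lookup (parts μ) i) K.*
    K.product λ j → K.product λ (i : Fin′ j) →
      (x (σ ⟨$⟩ʳ inject i) R.- t R.* x (σ ⟨$⟩ʳ j))
        / (x (σ ⟨$⟩ʳ inject i) R.- x (σ ⟨$⟩ʳ j)) [ xᵢ-xⱼ≉0 (σ-distinct σ i) ]

  P : Partition n → Fraction
  P μ = normalisation μ K.* List.foldr K._+_ K.0# (List.map (summand μ) (permutations n))

  -- The sequence is indexed by k ≥ 1 (a 0 is never used), and c i is the
  -- coefficient c_{i+1}.  The terms live in the field of fractions because P is
  -- defined there; as ι is injective, for polynomials aₖ this is the same as the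
  -- relation in ℤ[x₁,…,xₙ,t].
  SatisfiesLinearRecurrence : (ℕ → Fraction) → Set
  SatisfiesLinearRecurrence a =
    ∃ λ r → r ℕ.≥ 1 × Σ (Vector R.Carrier r) λ c →
      ∀ k → k ℕ.≥ suc r →
        a k K.+ K.sum (λ i → ι (c i) K.* a (k ℕ.∸ suc (toℕ i))) K.≈ K.0#

{-# OPTIONS --safe #-}
-- With Mσ = ∏ᵢ x_{σ(i)}^{λᵢ}, the σ-summand of P_{kλ} is Mσᵏ times a factor independent of k,
-- and for k ≥ 1 so is the normalisation, because the multiplicity of k·i in kλ is
-- that of i in λ.  So P_{kλ} is a linear combination of geometric sequences in k, and the
-- coefficients of the monic polynomial ∏_σ (T - Mσ) give a recurrence.
module Submission where

open import Data.Nat using (ℕ; _≥_)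
open import Defs

open import Level using (0ℓ)
open import Function.Base using (_∘_)
open import Function.Bundles using (_⇔_; mk⇔; Equivalence)
open import Data.Empty using (⊥-elim)
open import Data.Product using (_,_)
open import Data.Nat as ℕ using (zero; suc; s≤s; z≤n)
import Data.Nat.Properties as ℕ
open import Data.Nat.Divisibility using (_∣_; >⇒∤; ∣m+n∣m⇒∣n; ∣-refl; m∣m*n)
open import Data.Fin as Fin using (Fin; toℕ; Fin′; inject)
import Data.Fin.Properties as Fin
open import Data.Fin.Permutation as Perm using (Permutation; _⟨$⟩ʳ_)
open import Data.List as List using (List; []; _∷_; length)
open import Data.List.Relation.Unary.Any using (Any; here; there)
open import Data.Vec as Vec using (Vec; []; _∷_; lookup)
import Data.Vec.Properties as Vec
open import Relation.Nullary using (¬_; yes; no)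
open import Relation.Unary using (Pred; Decidable)
open import Relation.Binary.PropositionalEquality as ≡ using (_≡_)
open import Algebra.Bundles using (CommutativeRing; CommutativeMonoid)
open import Algebra.Morphism.Structures using (IsRingHomomorphism)
import Algebra.Definitions.RawMonoid as RawMonoid
import Algebra.Properties.CommutativeMonoid.Sum as MonoidSum
import Algebra.Properties.Semiring.Sum as SemiringSum
import Algebra.Properties.Semiring.Exp as Exp
import Algebra.Properties.Ring as RingProperties
import Algebra.Properties.CommutativeSemigroup as CommutativeSemigroupProperties
import Algebra.Solver.Ring.NaturalCoefficients.Default as SemiringSolver
import Relation.Binary.Reasoning.Setoid as SetoidReasoning

-- Linear recurrences for sums of geometric sequences.

module LinearRecurrence (A : CommutativeRing 0ℓ 0ℓ) where

  open CommutativeRing A hiding (zero)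
  open SemiringSum semiring
  open RingProperties ring using (-‿distribˡ-*)
  open CommutativeSemigroupProperties *-commutativeSemigroup using (x∙yz≈y∙xz)
  open SetoidReasoning setoid

  -- The coefficient of Tʳ⁻ⁱ in the product of T - m y over the r entries y of the list.
  charCoeff : {I : Set} → (I → Carrier) → List I → ℕ → Carrier
  charCoeff m []       zero    = 1#
  charCoeff m []       (suc i) = 0#
  charCoeff m (y ∷ ys) zero    = charCoeff m ys zero
  charCoeff m (y ∷ ys) (suc i) = charCoeff m ys (suc i) + - m y * charCoeff m ys i

  charCoeff-monic : ∀ {I : Set} (m : I → Carrier) ys → charCoeff m ys 0 ≈ 1#
  charCoeff-monic m []       = refl
  charCoeff-monic m (y ∷ ys) = charCoeff-monic m ys

  charCoeff-vanishes : ∀ {I : Set} (m : I → Carrier) ys {i} → length ys ℕ.< i → charCoeff m ys i ≈ 0#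
  charCoeff-vanishes m []       {suc i} _       = refl
  charCoeff-vanishes m (y ∷ ys) {suc i} (s≤s l) = begin
    charCoeff m ys (suc i) + - m y * charCoeff m ys i
      ≈⟨ +-cong (charCoeff-vanishes m ys (ℕ.m<n⇒m<1+n l)) (*-congˡ (charCoeff-vanishes m ys l)) ⟩
    0# + - m y * 0#  ≈⟨ +-identityˡ _ ⟩
    - m y * 0#       ≈⟨ zeroʳ _ ⟩
    0#               ∎

  sumUpTo : ℕ → (ℕ → Carrier) → Carrier
  sumUpTo n F = sum {n} (F ∘ toℕ)

  sumUpTo-cong : ∀ n F G → (∀ i → i ℕ.< n → F i ≈ G i) → sumUpTo n F ≈ sumUpTo n G
  sumUpTo-cong n F G e = sum-cong-≋ {n} {F ∘ toℕ} {G ∘ toℕ} λ i → e (toℕ i) (Fin.toℕ<n i)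

  sumUpTo-+ : ∀ n F G → sumUpTo n (λ i → F i + G i) ≈ sumUpTo n F + sumUpTo n G
  sumUpTo-+ n F G = ∑-distrib-+ {n} (F ∘ toℕ) (G ∘ toℕ)

  sumUpTo-*ˡ : ∀ n u F → sumUpTo n (λ i → u * F i) ≈ u * sumUpTo n F
  sumUpTo-*ˡ n u F = sym (*-distribˡ-sum {n} u (F ∘ toℕ))

  sumUpTo-suc : ∀ n F → sumUpTo (suc n) F ≈ sumUpTo n F + F n
  sumUpTo-suc n F = trans (sum-init-last {n} (F ∘ toℕ))
    (+-cong (sum-cong-≋ {n} {F ∘ toℕ ∘ Fin.inject₁} {F ∘ toℕ} λ i → reflexive (≡.cong F (Fin.toℕ-inject₁ i)))
            (reflexive (≡.cong F (Fin.toℕ-fromℕ n))))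

  -- Left-hand side at `k` of the order-`r` recurrence with coefficients `d`. The subtraction
  -- `k ∸ i` truncates, so it has this meaning only for `r ≤ k`.
  window : (ℕ → Carrier) → ℕ → (ℕ → Carrier) → ℕ → Carrier
  window d r a k = sumUpTo (suc r) λ i → d i * a (k ℕ.∸ i)

  window-+ : ∀ d r a b k → window d r (λ j → a j + b j) k ≈ window d r a k + window d r b k
  window-+ d r a b k = trans
    (sumUpTo-cong (suc r) (λ i → d i * (a (k ℕ.∸ i) + b (k ℕ.∸ i)))
      (λ i → d i * a (k ℕ.∸ i) + d i * b (k ℕ.∸ i)) λ i _ → distribˡ _ _ _)
    (sumUpTo-+ (suc r) (λ i → d i * a (k ℕ.∸ i)) (λ i → d i * b (k ℕ.∸ i)))

  -- The positions `k` and `l` are independent, so that one lemma covers both a shift of a geometric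
  -- sequence by one place and the extraction of a constant factor at a fixed place.
  window-scale : ∀ d r u a b k l → (∀ i → i ℕ.≤ r → a (k ℕ.∸ i) ≈ u * b (l ℕ.∸ i)) →
                 window d r a k ≈ u * window d r b l
  window-scale d r u a b k l e = trans
    (sumUpTo-cong (suc r) (λ i → d i * a (k ℕ.∸ i)) (λ i → u * (d i * b (l ℕ.∸ i)))
      λ { i (s≤s i≤r) → trans (*-congˡ (e i i≤r)) (x∙yz≈y∙xz _ _ _) })
    (sumUpTo-*ˡ (suc r) u (λ i → d i * b (l ℕ.∸ i)))

  window-extend : ∀ d r a k → d (suc r) ≈ 0# → window d (suc r) a k ≈ window d r a k
  window-extend d r a k d≈0 = begin
    window d (suc r) a k                                ≈⟨ sumUpTo-suc (suc r) (λ i → d i * a (k ℕ.∸ i)) ⟩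
    window d r a k + d (suc r) * a (k ℕ.∸ suc r)        ≈⟨ +-congˡ (trans (*-congʳ d≈0) (zeroˡ _)) ⟩
    window d r a k + 0#                                 ≈⟨ +-identityʳ _ ⟩
    window d r a k                                      ∎

  -- With `T` acting as the shift, this is the factorisation of the operator for `y ∷ ys` as
  -- `T - m y` after the operator for `ys`.
  window-charCoeff-∷ : ∀ {I : Set} (m : I → Carrier) y ys a k →
    window (charCoeff m (y ∷ ys)) (suc (length ys)) a (suc k)
      ≈ window (charCoeff m ys) (length ys) a (suc k) + - m y * window (charCoeff m ys) (length ys) a k
  window-charCoeff-∷ m y ys a k = begin
    d 0 * a (suc k) + sumUpTo (suc r) (λ i → (d (suc i) + - m y * d i) * a (k ℕ.∸ i))
      ≈⟨ +-congˡ (sumUpTo-cong (suc r) _ (λ i → upper i + - m y * lower i) λ i _ →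
           trans (distribʳ _ _ _) (+-congˡ (*-assoc _ _ _))) ⟩
    d 0 * a (suc k) + sumUpTo (suc r) (λ i → upper i + - m y * lower i)
      ≈⟨ +-congˡ (sumUpTo-+ (suc r) upper (λ i → - m y * lower i)) ⟩
    d 0 * a (suc k) + (sumUpTo (suc r) upper + sumUpTo (suc r) (λ i → - m y * lower i))
      ≈⟨ +-assoc _ _ _ ⟨
    window d (suc r) a (suc k) + sumUpTo (suc r) (λ i → - m y * lower i)
      -- The first sum runs one place too far for `ys`; its extra coefficient lies beyond the degree
      -- and vanishes.
      ≈⟨ +-cong (window-extend d r a (suc k) (charCoeff-vanishes m ys ℕ.≤-refl))
                (sumUpTo-*ˡ (suc r) (- m y) lower) ⟩
    window d r a (suc k) + - m y * window d r a k ∎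
    where
    d = charCoeff m ys
    r = length ys
    upper lower : ℕ → Carrier
    upper i = d (suc i) * a (k ℕ.∸ i)
    lower i = d i * a (k ℕ.∸ i)

  -- A `foldr` over a `map`, to agree by computation with the sum over permutations in `P`.
  geometricSum : {I : Set} → (I → ℕ → Carrier) → List I → ℕ → Carrier
  geometricSum g ys k = List.foldr _+_ 0# (List.map (λ y → g y k) ys)

  -- Induction on the list: the operator for `ys` kills the terms of `ys`, and the remaining factor
  -- `T - m y` kills the sequence `g y`.
  charCoeff-annihilates : ∀ {I : Set} (m : I → Carrier) (g : I → ℕ → Carrier) →
    (∀ y k → g y (suc k) ≈ m y * g y k) →
    ∀ ys {k} → length ys ℕ.≤ k → window (charCoeff m ys) (length ys) (geometricSum g ys) k ≈ 0#
  charCoeff-annihilates m g geometric []       _ = trans (+-identityʳ _) (*-identityˡ _)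
  charCoeff-annihilates m g geometric (y ∷ ys) {suc k} (s≤s r≤k) = begin
    window (charCoeff m (y ∷ ys)) (suc r) (λ j → g y j + s j) (suc k)
      ≈⟨ window-charCoeff-∷ m y ys (λ j → g y j + s j) k ⟩
    W (λ j → g y j + s j) (suc k) + - m y * W (λ j → g y j + s j) k
      ≈⟨ +-cong (drop-s (ℕ.m≤n⇒m≤1+n r≤k)) (*-congˡ (drop-s r≤k)) ⟩
    W (g y) (suc k) + - m y * W (g y) k
      -- The bound `i ≤ r ≤ k` makes `suc k ∸ i` the successor of `k ∸ i`, so the ratio `m y` can be
      -- taken out of every term.
      ≈⟨ +-cong (window-scale (charCoeff m ys) r (m y) (g y) (g y) (suc k) k λ i i≤r → trans
           (reflexive (≡.cong (g y) (ℕ.+-∸-assoc 1 (ℕ.≤-trans i≤r r≤k))))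
           (geometric y (k ℕ.∸ i)))
           (sym (-‿distribˡ-* _ _)) ⟩
    m y * W (g y) k - m y * W (g y) k
      ≈⟨ -‿inverseʳ _ ⟩
    0# ∎
    where
    r = length ys
    s = geometricSum g ys
    W = window (charCoeff m ys) r
    drop-s : ∀ {k} → r ℕ.≤ k → W (λ j → g y j + s j) k ≈ W (g y) k
    drop-s {k} r≤k = trans (window-+ (charCoeff m ys) r (g y) s k)
      (trans (+-congˡ (charCoeff-annihilates m g geometric ys r≤k)) (+-identityʳ _))

-- Products whose factors are trivial away from multiples.

module SparseProduct (M : CommutativeMonoid 0ℓ 0ℓ) where

  open CommutativeMonoid M
  open RawMonoid rawMonoid using () renaming (sum to product)
  open SetoidReasoning setoid

  product-drop : ∀ p q (F : ℕ → Carrier) → (∀ j → j ℕ.< p → F j ≈ ε) →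
                 product {p ℕ.+ q} (F ∘ toℕ) ≈ product {q} (λ i → F (p ℕ.+ toℕ i))
  product-drop zero    q F F≈ε = refl
  product-drop (suc p) q F F≈ε = begin
    F 0 ∙ product {p ℕ.+ q} (F ∘ suc ∘ toℕ)        ≈⟨ ∙-congʳ (F≈ε 0 ℕ.z<s) ⟩
    ε ∙ product {p ℕ.+ q} (F ∘ suc ∘ toℕ)          ≈⟨ identityˡ _ ⟩
    product {p ℕ.+ q} (F ∘ suc ∘ toℕ)              ≈⟨ product-drop p q (F ∘ suc) (λ j j<p → F≈ε (suc j) (s≤s j<p)) ⟩
    product {q} (λ i → F (suc p ℕ.+ toℕ i))        ∎

  -- Induction on `L`: keep the factor at 0, drop the `k` trivial factors after it, and continue
  -- with `F` shifted by `suc k`, which preserves divisibility by `suc k`.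
  product-multiples : ∀ k L (F : ℕ → Carrier) → (∀ j → ¬ suc k ∣ j → F j ≈ ε) →
    product {suc (L ℕ.* suc k)} (F ∘ toℕ) ≈ product {suc L} (λ i → F (toℕ i ℕ.* suc k))
  product-multiples k zero    F F≈ε = refl
  product-multiples k (suc L) F F≈ε = ∙-congˡ (begin
    product {suc (k ℕ.+ L ℕ.* suc k)} (F ∘ suc ∘ toℕ)
      ≡⟨ ≡.cong (λ n → product {n} (F ∘ suc ∘ toℕ)) (ℕ.+-suc k (L ℕ.* suc k)) ⟨
    product {k ℕ.+ suc (L ℕ.* suc k)} (F ∘ suc ∘ toℕ)
      ≈⟨ product-drop k (suc (L ℕ.* suc k)) (F ∘ suc) (λ j j<k → F≈ε (suc j) (>⇒∤ (s≤s j<k))) ⟩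
    product {suc (L ℕ.* suc k)} (λ i → F (suc k ℕ.+ toℕ i))
      ≈⟨ product-multiples k L (λ j → F (suc k ℕ.+ j)) (λ j k∤j → F≈ε _ λ k∣ → k∤j (∣m+n∣m⇒∣n k∣ ∣-refl)) ⟩
    product {suc L} (λ i → F (suc (toℕ i) ℕ.* suc k)) ∎)

-- Multiplicities and largest part of a scaled partition.

module _ {A B : Set} {P : Pred B 0ℓ} (P? : Decidable P) (f : A → B) where

  count-map : {Q : Pred A 0ℓ} (Q? : Decidable Q) → (∀ a → P (f a) ⇔ Q a) →
              ∀ {n} (v : Vec A n) → Vec.count P? (Vec.map f v) ≡ Vec.count Q? v
  count-map Q? P⇔Q []      = ≡.refl
  count-map Q? P⇔Q (a ∷ v) with P? (f a) | Q? a
  ... | yes p | yes q = ≡.cong suc (count-map Q? P⇔Q v)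
  ... | yes p | no ¬q = ⊥-elim (¬q (Equivalence.to (P⇔Q a) p))
  ... | no ¬p | yes q = ⊥-elim (¬p (Equivalence.from (P⇔Q a) q))
  ... | no ¬p | no ¬q = count-map Q? P⇔Q v

  count-map-none : (∀ a → ¬ P (f a)) → ∀ {n} (v : Vec A n) → Vec.count P? (Vec.map f v) ≡ 0
  count-map-none none []      = ≡.refl
  count-map-none none (a ∷ v) with P? (f a)
  ... | yes p = ⊥-elim (none a p)
  ... | no _  = count-map-none none v

-- The scale is `suc k` because cancellation needs a positive factor: scaling by 0 merges all parts
-- into 0.
multiplicity-⊛-multiple : ∀ {n} k (μ : Partition n) i →
                          multiplicity (suc k ⊛ μ) (i ℕ.* suc k) ≡ multiplicity μ i
multiplicity-⊛-multiple k μ i = count-map (ℕ._≟ i ℕ.* suc k) (suc k ℕ.*_) (ℕ._≟ i)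
  (λ a → mk⇔ (λ e → ℕ.*-cancelʳ-≡ a i (suc k) (≡.trans (ℕ.*-comm a (suc k)) e))
             (λ e → ≡.trans (ℕ.*-comm (suc k) a) (≡.cong (ℕ._* suc k) e)))
  (parts μ)

multiplicity-⊛-nonmultiple : ∀ {n} k (μ : Partition n) {j} → ¬ k ∣ j → multiplicity (k ⊛ μ) j ≡ 0
multiplicity-⊛-nonmultiple k μ {j} k∤j = count-map-none (ℕ._≟ j) (k ℕ.*_)
  (λ a e → k∤j (≡.subst (k ∣_) e (m∣m*n a))) (parts μ)

largestPart-⊛ : ∀ {n} k (μ : Partition n) → largestPart (k ⊛ μ) ≡ largestPart μ ℕ.* k
largestPart-⊛ k μ = go (parts μ)
  where
  go : ∀ {n} (v : Vec ℕ n) → Vec.foldr (λ _ → ℕ) ℕ._⊔_ 0 (Vec.map (k ℕ.*_) v)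
                            ≡ Vec.foldr (λ _ → ℕ) ℕ._⊔_ 0 v ℕ.* k
  go []      = ≡.refl
  go (a ∷ v) = ≡.trans (≡.cong₂ ℕ._⊔_ (ℕ.*-comm k a) (go v)) (≡.sym (ℕ.*-distribʳ-⊔ k a _))

-- Positivity of the order of the recurrence.

permutations-nonEmpty : ∀ n → length (permutations n) ≥ 1
permutations-nonEmpty n = nonEmpty (permutations-complete {n} Perm.id)
  where
  nonEmpty : ∀ {A : Set} {P : Pred A 0ℓ} {xs} → Any P xs → length xs ≥ 1
  nonEmpty (here _)  = s≤s z≤n
  nonEmpty (there _) = s≤s z≤n

-- Recurrences in `A` with coefficients from `B`.

module TransportedRecurrence
  (B A : CommutativeRing 0ℓ 0ℓ)
  {ι : CommutativeRing.Carrier B → CommutativeRing.Carrier A}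
  (ι-isRingHomomorphism : IsRingHomomorphism (CommutativeRing.rawRing B) (CommutativeRing.rawRing A) ι) where

  private module B = CommutativeRing B
  open CommutativeRing A hiding (zero)
  open IsRingHomomorphism ι-isRingHomomorphism
  open SemiringSum semiring using (sum)
  open LinearRecurrence using (charCoeff)
  open LinearRecurrence A hiding (charCoeff)
  open SetoidReasoning setoid

  -- The recurrence is verified among fractions, while its coefficients have to be polynomials; this
  -- identifies the two versions of the coefficients.
  charCoeff-homo : ∀ {I : Set} (m : I → B.Carrier) ys i →
                   ι (charCoeff B m ys i) ≈ charCoeff A (ι ∘ m) ys i
  charCoeff-homo m []       zero    = 1#-homo
  charCoeff-homo m []       (suc i) = 0#-homo
  charCoeff-homo m (y ∷ ys) zero    = charCoeff-homo m ys zero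
  charCoeff-homo m (y ∷ ys) (suc i) = trans (+-homo _ _) (+-cong (charCoeff-homo m ys (suc i))
    (trans (*-homo _ _) (*-cong (-‿homo _) (charCoeff-homo m ys i))))

  -- `N` is constant only from index 1 on. For `k ≥ suc r` every index `k ∸ i` with `i ≤ r` is
  -- positive, so `N` comes out of the window as the constant `u`.
  scaledGeometricSum-recurrence : ∀ {I : Set} (m : I → B.Carrier) (w : I → ℕ → B.Carrier) (b : I → Carrier) →
    (∀ y k → w y (suc k) B.≈ m y B.* w y k) →
    ∀ ys (N : ℕ → Carrier) u → (∀ k → N (suc k) ≈ u) →
    let a = λ k → N k * geometricSum (λ y k → ι (w y k) * b y) ys k in
    ∀ k → k ≥ suc (length ys) →
      a k + sum (λ (i : Fin (length ys)) →
        ι (charCoeff B m ys (suc (toℕ i))) * a (k ℕ.∸ suc (toℕ i))) ≈ 0#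
  scaledGeometricSum-recurrence m w b geometric ys N u N≈u k r<k = begin
    a k + sumUpTo r (λ i → ι (c (suc i)) * a (k ℕ.∸ suc i))
      -- Monicity turns the isolated `a k` into the term `i = 0` of the window.
      ≈⟨ +-cong
           (trans (sym (*-identityˡ (a k))) (*-congʳ (sym (charCoeff-monic (ι ∘ m) ys))))
           (sumUpTo-cong r _ (λ i → d (suc i) * a (k ℕ.∸ suc i)) λ i _ → *-congʳ (charCoeff-homo m ys (suc i))) ⟩
    window d r a k
      ≈⟨ window-scale d r u a s k k (λ i i≤r → a≈us (ℕ.m<n⇒0<n∸m (ℕ.≤-<-trans i≤r r<k))) ⟩
    u * window d r s k
      ≈⟨ *-congˡ (charCoeff-annihilates (ι ∘ m) g
           (λ y k → trans (*-congʳ (trans (⟦⟧-cong (geometric y k)) (*-homo _ _))) (*-assoc _ _ _))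
           ys (ℕ.<⇒≤ r<k)) ⟩
    u * 0#
      ≈⟨ zeroʳ u ⟩
    0# ∎
    where
    r = length ys
    c = charCoeff B m ys
    d = charCoeff A (ι ∘ m) ys
    g = λ y k → ι (w y k) * b y
    s a : ℕ → Carrier
    s = geometricSum g ys
    a k = N k * s k
    a≈us : ∀ {k} → 0 ℕ.< k → a k ≈ u * s k
    a≈us {suc k} _ = *-congʳ (N≈u k)

-- The embedding of a domain into its fractions.

module _ (D : IntegralDomain) where

  private module D = IntegralDomain D
  open FieldOfFractions D
  open SemiringSolver D.commutativeSemiring using (solve; _:+_; _:*_; _:=_; con)

  ι-isRingHomomorphism : IsRingHomomorphism D.rawRing (CommutativeRing.rawRing fractionRing) ι
  ι-isRingHomomorphism = record
    { isSemiringHomomorphism = record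
      { isNearSemiringHomomorphism = record
        { +-isMonoidHomomorphism = record
          { isMagmaHomomorphism = record
            { isRelHomomorphism = record { cong = λ e → cross (D.*-congʳ e) }
            ; homo = λ a b → cross (solve 2 (λ a b →
                (a :+ b) :* (con 1 :* con 1) := (a :* con 1 :+ b :* con 1) :* con 1) D.refl a b)
            }
          ; ε-homo = cross D.refl
          }
        ; *-homo = λ a b → cross (solve 2 (λ a b →
            (a :* b) :* (con 1 :* con 1) := (a :* b) :* con 1) D.refl a b)
        }
      ; 1#-homo = cross D.refl
      }
    ; -‿homo = λ a → cross D.refl
    }

-- Independence of the normalisation from the scale.

module MultiplicityProduct (M : CommutativeMonoid 0ℓ 0ℓ) where

  open CommutativeMonoid M
  open RawMonoid rawMonoid using () renaming (sum to product)
  open MonoidSum M using () renaming (sum-cong-≋ to product-cong)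
  open SparseProduct M
  open SetoidReasoning setoid

  -- The shape of `normalisation`, where `f m` is the product of `(1 - t) / (1 - t^j)` over
  -- `1 ≤ j ≤ m`.
  multiplicityProduct : ∀ {n} → (ℕ → Carrier) → Partition n → Carrier
  multiplicityProduct f μ = product {suc (largestPart μ)} λ i → f (multiplicity μ (toℕ i))

  -- Non-multiples of `suc k` have multiplicity 0 and contribute `f 0 ≈ ε`; the factors at multiples
  -- are those of `μ`.
  multiplicityProduct-⊛ : ∀ {n} (f : ℕ → Carrier) → f 0 ≈ ε → ∀ k (μ : Partition n) →
                          multiplicityProduct f (suc k ⊛ μ) ≈ multiplicityProduct f μ
  multiplicityProduct-⊛ f f0≈ε k μ = begin
    product {suc (largestPart (suc k ⊛ μ))} (F ∘ toℕ)
      ≡⟨ ≡.cong (λ L → product {suc L} (F ∘ toℕ)) (largestPart-⊛ (suc k) μ) ⟩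
    product {suc (largestPart μ ℕ.* suc k)} (F ∘ toℕ)
      ≈⟨ product-multiples k (largestPart μ) F
           (λ j k∤j → trans (reflexive (≡.cong f (multiplicity-⊛-nonmultiple (suc k) μ k∤j))) f0≈ε) ⟩
    product {suc (largestPart μ)} (λ i → F (toℕ i ℕ.* suc k))
      ≈⟨ product-cong {suc (largestPart μ)} {λ i → F (toℕ i ℕ.* suc k)} {λ i → f (multiplicity μ (toℕ i))}
           (λ i → reflexive (≡.cong f (multiplicity-⊛-multiple k μ (toℕ i)))) ⟩
    multiplicityProduct f μ ∎
    where
    F : ℕ → Carrier
    F j = f (multiplicity (suc k ⊛ μ) j)

-- Monomials of scaled partitions as geometric sequences.

module Monomial (D : IntegralDomain) where

  open IntegralDomain D
  open Exp semiring using (^-homo-*)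
  open MonoidSum *-commutativeMonoid using ()
    renaming (sum-cong-≋ to product-cong; ∑-distrib-+ to product-distrib-*)
  open SetoidReasoning setoid

  monomial : ∀ {n} → (Fin n → Carrier) → Partition n → Carrier
  monomial y μ = product λ i → y i ^ lookup (parts μ) i

  monomial-⊛ : ∀ {n} (y : Fin n → Carrier) k μ →
               monomial y (suc k ⊛ μ) ≈ monomial y μ * monomial y (k ⊛ μ)
  monomial-⊛ y k μ = trans (product-cong λ i → begin
      y i ^ lookup (Vec.map (suc k ℕ.*_) (parts μ)) i
        ≡⟨ ≡.cong (y i ^_) (Vec.lookup-map i (suc k ℕ.*_) (parts μ)) ⟩
      y i ^ (lookup (parts μ) i ℕ.+ k ℕ.* lookup (parts μ) i)
        ≈⟨ ^-homo-* (y i) (lookup (parts μ) i) _ ⟩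
      y i ^ lookup (parts μ) i * y i ^ (k ℕ.* lookup (parts μ) i)
        ≡⟨ ≡.cong (λ e → y i ^ lookup (parts μ) i * y i ^ e) (Vec.lookup-map i (k ℕ.*_) (parts μ)) ⟨
      y i ^ lookup (parts μ) i * y i ^ lookup (Vec.map (k ℕ.*_) (parts μ)) i ∎)
    (product-distrib-* (λ i → y i ^ lookup (parts μ) i) (λ i → y i ^ lookup (parts (k ⊛ μ)) i))

-- The recurrence for Hall-Littlewood polynomials.

mainTheorem4 : (n : ℕ) → n ≥ 1 → (μ : Partition n) →
    HallLittlewood.SatisfiesLinearRecurrence n (λ k → HallLittlewood.P n (k ⊛ μ))
mainTheorem4 n _ μ =
    length σs , permutations-nonEmpty n
  -- Shifted by one, since the coefficient at index 0 is the leading 1.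
  , (λ i → charCoeff R.commutativeRing M σs (suc (toℕ i)))
  -- `P (k ⊛ μ)` unfolds to the scaled sum treated there: each `summand` is by definition the
  -- embedded monomial times `interaction σ`.
  , scaledGeometricSum-recurrence M (λ σ k → monomial (y σ) (k ⊛ μ)) interaction
      (λ σ k → monomial-⊛ (y σ) k μ) σs
      (λ k → normalisation (k ⊛ μ)) (normalisation μ)
      -- `factor 0` is an empty product, hence 1 by computation.
      (λ k → multiplicityProduct-⊛ factor K.refl k μ)
  where
  open HallLittlewood n
  open TransportedRecurrence R.commutativeRing fractionRing (ι-isRingHomomorphism ℤ[𝐱,t])
  open MultiplicityProduct K.*-commutativeMonoid
  open Monomial ℤ[𝐱,t]
  open LinearRecurrence using (charCoeff)
  σs = permutations n
  y : Permutation n n → Fin n → R.Carrier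
  y σ i = x (σ ⟨$⟩ʳ i)
  M : Permutation n n → R.Carrier
  M σ = monomial (y σ) μ
  interaction : Permutation n n → Fraction
  interaction σ = K.product λ j → K.product λ (i : Fin′ j) →
    (x (σ ⟨$⟩ʳ inject i) R.- t R.* x (σ ⟨$⟩ʳ j))
      / (x (σ ⟨$⟩ʳ inject i) R.- x (σ ⟨$⟩ʳ j)) [ xᵢ-xⱼ≉0 (σ-distinct σ i) ]
  factor : ℕ → Fraction
  factor m = K.product {m} λ j → (R.1# R.- t) / (R.1# R.- t R.^ suc (toℕ j)) [ 1-tʲ≉0 (toℕ j) ]
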